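{- Every Euclidean unit disk graph is a hyperbolic unit disk graph.
   Context: Graphs are finite, simple and undirected. A graph $G=(V,E)$ is a Euclidean unit disk graph if there exist a mapping $\phi\colon V\to\mathbb{R}^2$ and a threshold radius $R>0$ such that for all distinct $u,v\in V$: $\{u,v\}\in E$ if and only if the Euclidean distance between $\phi(u)$ and $\phi(v)$ is at most $R$. A graph $G=(V,E)$ is a hyperbolic unit disk graph if there exist a mapping $\phi\colon V\to\mathbb{H}^2$ into the hyperbolic plane (of curvature $-1$) and a threshold radius $R>0$ such that for all distinct $u,v\in V$: $\{u,v\}\in E$ if and only if the hyperbolic distance satisfies $d_{\mathbb{H}^2}(\phi(u),\phi(v))\le R$. In both cases the threshold radius $R$ is part of the representation and may depend on the graph. -}

module Defs where

open import Algebra.Bundles using (CommutativeRing; Semiring)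
import Algebra.Definitions.RawSemiring as RawSemiringOperations
import Algebra.Properties.Monoid.Mult as MonoidMult
import Algebra.Properties.Ring as RingProperties
import Algebra.Properties.Semiring.Exp as SemiringExp
import Algebra.Properties.Semiring.Mult as SemiringMult
open import Data.Fin.Base using (Fin)
open import Data.Nat.Base as ℕ using (ℕ; zero; suc; _!)
import Data.Nat.Properties as ℕₚ
open import Data.Product.Base using (∃; _×_; _,_; proj₁; proj₂)
open import Data.Sum.Base using (inj₁; inj₂)
open import Function.Bundles using (_⇔_)
open import Level using (0ℓ)
open import Relation.Binary.Bundles using (Poset)
import Relation.Binary.Construct.NonStrictToStrict as ToStrict
open import Relation.Binary.Core using (Rel)
open import Relation.Binary.Definitions using (Symmetric)
open import Relation.Binary.PropositionalEquality.Core as ≡ using (_≡_; _≢_)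
import Relation.Binary.Reasoning.PartialOrder as PartialOrderReasoning
open import Relation.Binary.Structures using (IsDecTotalOrder)
open import Relation.Nullary using (¬_; yes; no; contradiction)
open import Relation.Unary using (Pred)

-- The classical real numbers, axiomatised up to isomorphism as a complete
-- ordered field.  Decidability of the order and `archimedean` are consequences
-- of the other axioms in classical logic; they are fields here because without
-- excluded middle neither the decision nor the witness n can be extracted.
record CompleteOrderedField : Set₁ where
  infix 4 _≤_
  field
    commutativeRing : CommutativeRing 0ℓ 0ℓ

  open CommutativeRing commutativeRing public

  field
    1≉0     : ¬ (1# ≈ 0#)
    inverse : ∀ x → ¬ (x ≈ 0#) → ∃ λ y → x * y ≈ 1#

    _≤_             : Rel Carrier 0ℓ
    isDecTotalOrder : IsDecTotalOrder _≈_ _≤_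
    +-monoˡ-≤       : ∀ z {x y} → x ≤ y → x + z ≤ y + z
    *-nonneg        : ∀ {x y} → 0# ≤ x → 0# ≤ y → 0# ≤ x * y

  IsUpperBound : Pred Carrier 0ℓ → Carrier → Set
  IsUpperBound P u = ∀ x → P x → x ≤ u

  IsLeastUpperBound : Pred Carrier 0ℓ → Carrier → Set
  IsLeastUpperBound P s = IsUpperBound P s × (∀ u → IsUpperBound P u → s ≤ u)

  open RawSemiringOperations (Semiring.rawSemiring semiring) public
    using (_^_) renaming (_×_ to _ℕ*_)

  fromℕ : ℕ → Carrier
  fromℕ n = n ℕ* 1#

  field
    complete    : (P : Pred Carrier 0ℓ) → ∃ P → ∃ (IsUpperBound P) →
                  ∃ (IsLeastUpperBound P)
    archimedean : ∀ x → ∃ λ n → x ≤ fromℕ n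

  open ToStrict _≈_ _≤_ public using (_<_)

module Analysis (ℝ : CompleteOrderedField) where

  open CompleteOrderedField ℝ
  private
    module R = CommutativeRing commutativeRing
    module ≤ = IsDecTotalOrder isDecTotalOrder
    open RingProperties R.ring using (-‿distribˡ-*; -‿distribʳ-*)
    open import Algebra.Properties.Group R.+-group using (⁻¹-involutive)
    open SemiringMult R.semiring using (×1-homo-*)
    open MonoidMult R.+-monoid using (×-homo-+)
    open SemiringExp R.semiring using (^-assocʳ; ^-homo-*)

  poset : Poset 0ℓ 0ℓ 0ℓ
  poset = record { isPartialOrder = ≤.isPartialOrder }

  open PartialOrderReasoning poset hiding (_IsRelatedTo_)

  ⨆ : (P : Pred Carrier 0ℓ) → ∃ P → ∃ (IsUpperBound P) → Carrier
  ⨆ P inhabited bounded = proj₁ (complete P inhabited bounded)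

  ⨆-isLeastUpperBound : ∀ P inhabited bounded →
                        IsLeastUpperBound P (⨆ P inhabited bounded)
  ⨆-isLeastUpperBound P inhabited bounded = proj₂ (complete P inhabited bounded)

  infix 8 _⁻¹
  infixl 7 _/_

  -- Made total by 0# ⁻¹ = 0#; below it is applied to positive numbers only.
  _⁻¹ : Carrier → Carrier
  x ⁻¹ with x ≤.≟ 0#
  ... | yes _  = 0#
  ... | no x≉0 = proj₁ (inverse x x≉0)

  _/_ : Carrier → Carrier → Carrier
  x / y = x * y ⁻¹

  +-monoʳ-≤ : ∀ z {x y} → x ≤ y → z + x ≤ z + y
  +-monoʳ-≤ z {x} {y} x≤y = begin
    z + x  ≈⟨ +-comm z x ⟩
    x + z  ≤⟨ +-monoˡ-≤ z x≤y ⟩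
    y + z  ≈⟨ +-comm y z ⟩
    z + y  ∎

  +-mono-≤ : ∀ {x y u v} → x ≤ y → u ≤ v → x + u ≤ y + v
  +-mono-≤ {x} {y} {u} {v} x≤y u≤v = begin
    x + u  ≤⟨ +-monoˡ-≤ u x≤y ⟩
    y + u  ≤⟨ +-monoʳ-≤ y u≤v ⟩
    y + v  ∎

  x≤x+y : ∀ {x y} → 0# ≤ y → x ≤ x + y
  x≤x+y {x} {y} 0≤y = begin
    x       ≈⟨ +-identityʳ x ⟨
    x + 0#  ≤⟨ +-monoʳ-≤ x 0≤y ⟩
    x + y   ∎

  +-nonneg : ∀ {x y} → 0# ≤ x → 0# ≤ y → 0# ≤ x + y
  +-nonneg 0≤x 0≤y = ≤.trans 0≤x (x≤x+y 0≤y)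

  *-monoʳ-≤ : ∀ {z x y} → 0# ≤ z → x ≤ y → x * z ≤ y * z
  *-monoʳ-≤ {z} {x} {y} 0≤z x≤y = begin
    x * z                  ≤⟨ x≤x+y (*-nonneg 0≤y-x 0≤z) ⟩
    x * z + (y - x) * z    ≈⟨ distribʳ z x (y - x) ⟨
    (x + (y - x)) * z      ≈⟨ *-congʳ (+-comm x (y - x)) ⟩
    (y - x + x) * z        ≈⟨ *-congʳ (+-assoc y (- x) x) ⟩
    (y + (- x + x)) * z    ≈⟨ *-congʳ (+-congˡ (-‿inverseˡ x)) ⟩
    (y + 0#) * z           ≈⟨ *-congʳ (+-identityʳ y) ⟩
    y * z                  ∎
    where
    0≤y-x : 0# ≤ y - x
    0≤y-x = begin
      0#     ≈⟨ -‿inverseʳ x ⟨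
      x - x  ≤⟨ +-monoˡ-≤ (- x) x≤y ⟩
      y - x  ∎

  *-monoˡ-≤ : ∀ {z x y} → 0# ≤ z → x ≤ y → z * x ≤ z * y
  *-monoˡ-≤ {z} {x} {y} 0≤z x≤y = begin
    z * x  ≈⟨ *-comm z x ⟩
    x * z  ≤⟨ *-monoʳ-≤ 0≤z x≤y ⟩
    y * z  ≈⟨ *-comm y z ⟩
    z * y  ∎

  square-nonneg : ∀ x → 0# ≤ x * x
  square-nonneg x with ≤.total 0# x
  ... | inj₁ 0≤x = *-nonneg 0≤x 0≤x
  ... | inj₂ x≤0 = begin
    0#           ≤⟨ *-nonneg 0≤-x 0≤-x ⟩
    - x * - x    ≈⟨ -‿distribˡ-* x (- x) ⟨
    - (x * - x)  ≈⟨ -‿cong (-‿distribʳ-* x x) ⟨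
    - - (x * x)  ≈⟨ ⁻¹-involutive (x * x) ⟩
    x * x        ∎
    where
    0≤-x : 0# ≤ - x
    0≤-x = begin
      0#      ≈⟨ -‿inverseʳ x ⟨
      x - x   ≤⟨ +-monoˡ-≤ (- x) x≤0 ⟩
      0# - x  ≈⟨ +-identityˡ (- x) ⟩
      - x     ∎

  0≤1 : 0# ≤ 1#
  0≤1 = begin
    0#       ≤⟨ square-nonneg 1# ⟩
    1# * 1#  ≈⟨ *-identityˡ 1# ⟩
    1#       ∎

  ⁻¹-inverseʳ : ∀ {x} → ¬ (x ≈ 0#) → x * x ⁻¹ ≈ 1#
  ⁻¹-inverseʳ {x} x≉0 with x ≤.≟ 0#
  ... | yes x≈0  = contradiction x≈0 x≉0
  ... | no  x≉0′ = proj₂ (inverse x x≉0′)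

  ⁻¹-nonneg : ∀ {x} → 0# ≤ x → 0# ≤ x ⁻¹
  ⁻¹-nonneg {x} 0≤x with x ≤.≟ 0#
  ... | yes _  = ≤.refl
  ... | no x≉0 with inverse x x≉0
  ...   | y , xy≈1 with ≤.total 0# y
  ...     | inj₁ 0≤y = 0≤y
  ...     | inj₂ y≤0 = contradiction (≤.antisym 1≤0 0≤1) 1≉0
    where
    1≤0 : 1# ≤ 0#
    1≤0 = begin
      1#      ≈⟨ xy≈1 ⟨
      x * y   ≤⟨ *-monoˡ-≤ 0≤x y≤0 ⟩
      x * 0#  ≈⟨ zeroʳ x ⟩
      0#      ∎

  fromℕ-nonneg : ∀ n → 0# ≤ fromℕ n
  fromℕ-nonneg zero    = ≤.refl
  fromℕ-nonneg (suc n) = +-nonneg 0≤1 (fromℕ-nonneg n)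

  fromℕ-≉0 : ∀ n .{{_ : ℕ.NonZero n}} → ¬ (fromℕ n ≈ 0#)
  fromℕ-≉0 (suc n) eq = 1≉0 (≤.antisym 1≤0 0≤1)
    where
    1≤0 : 1# ≤ 0#
    1≤0 = begin
      1#            ≤⟨ x≤x+y (fromℕ-nonneg n) ⟩
      1# + fromℕ n  ≈⟨ eq ⟩
      0#            ∎

  fromℕ-mono-≤ : ∀ {m n} → m ℕ.≤ n → fromℕ m ≤ fromℕ n
  fromℕ-mono-≤ {n = n} ℕ.z≤n = fromℕ-nonneg n
  fromℕ-mono-≤ (ℕ.s≤s m≤n)   = +-monoʳ-≤ 1# (fromℕ-mono-≤ m≤n)

  x≤1+x² : ∀ x → x ≤ 1# + x * x
  x≤1+x² x with ≤.total x 1#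
  ... | inj₁ x≤1 = ≤.trans x≤1 (x≤x+y (square-nonneg x))
  ... | inj₂ 1≤x = begin
    x           ≈⟨ *-identityˡ x ⟨
    1# * x      ≤⟨ *-monoʳ-≤ (≤.trans 0≤1 1≤x) 1≤x ⟩
    x * x       ≤⟨ x≤x+y 0≤1 ⟩
    x * x + 1#  ≈⟨ +-comm (x * x) 1# ⟩
    1# + x * x  ∎

  sqrt : ∀ a → 0# ≤ a → Carrier
  sqrt a 0≤a = ⨆ (λ x → 0# ≤ x × x * x ≤ a)
    (0# , ≤.refl , ≤.trans (≤.reflexive (zeroˡ 0#)) 0≤a)
    (1# + a , λ x (_ , x²≤a) → ≤.trans (x≤1+x² x) (+-monoʳ-≤ 1# x²≤a))

  coshTerm : Carrier → ℕ → Carrier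
  coshTerm x k = x ^ (2 ℕ.* k) / fromℕ ((2 ℕ.* k) !)

  coshPartial : Carrier → ℕ → Carrier
  coshPartial x zero    = 0#
  coshPartial x (suc n) = coshPartial x n + coshTerm x n

  private
    ^2≈ : ∀ x → x ^ 2 ≈ x * x
    ^2≈ x = *-congˡ (*-identityʳ x)

    ^-nonneg : ∀ {x} n → 0# ≤ x → 0# ≤ x ^ n
    ^-nonneg zero    0≤x = 0≤1
    ^-nonneg (suc n) 0≤x = *-nonneg 0≤x (^-nonneg n 0≤x)

    ^2k-nonneg : ∀ x k → 0# ≤ x ^ (2 ℕ.* k)
    ^2k-nonneg x k = begin
      0#             ≤⟨ ^-nonneg k (≤.trans (square-nonneg x)
                                     (≤.reflexive (R.sym (^2≈ x)))) ⟩
      (x ^ 2) ^ k    ≈⟨ ^-assocʳ x 2 k ⟩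
      x ^ (2 ℕ.* k)  ∎

  coshTerm-nonneg : ∀ x k → 0# ≤ coshTerm x k
  coshTerm-nonneg x k =
    *-nonneg (^2k-nonneg x k) (⁻¹-nonneg (fromℕ-nonneg ((2 ℕ.* k) !)))

  private
    halving : ∀ x k → x * x ≤ fromℕ k →
              coshTerm x (suc k) + coshTerm x (suc k) ≤ coshTerm x k
    halving x k x²≤k = begin
      coshTerm x (suc k) + coshTerm x (suc k)
        ≈⟨ distribʳ (b ⁻¹) (x ^ (2 ℕ.* suc k)) (x ^ (2 ℕ.* suc k)) ⟨
      (x ^ (2 ℕ.* suc k) + x ^ (2 ℕ.* suc k)) * b ⁻¹
        ≈⟨ *-congʳ (+-cong pow pow) ⟩
      (p * (x * x) + p * (x * x)) * b ⁻¹
        ≈⟨ *-congʳ (distribˡ p (x * x) (x * x)) ⟨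
      p * (x * x + x * x) * b ⁻¹
        ≤⟨ *-monoʳ-≤ (⁻¹-nonneg (fromℕ-nonneg ((2 ℕ.* suc k) !)))
             (*-monoˡ-≤ (^2k-nonneg x k) 2x²≤c) ⟩
      p * c * b ⁻¹
        ≈⟨ *-assoc p c (b ⁻¹) ⟩
      p * (c * b ⁻¹)
        ≈⟨ *-congˡ cb⁻¹≈a⁻¹ ⟩
      p * a ⁻¹ ∎
      where
      p = x ^ (2 ℕ.* k)
      a = fromℕ ((2 ℕ.* k) !)
      b = fromℕ ((2 ℕ.* suc k) !)
      m = (2 ℕ.+ 2 ℕ.* k) ℕ.* (1 ℕ.+ 2 ℕ.* k)
      c = fromℕ m

      2[1+k]≡ : 2 ℕ.* suc k ≡ 2 ℕ.+ 2 ℕ.* k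
      2[1+k]≡ = ℕₚ.*-suc 2 k

      pow : x ^ (2 ℕ.* suc k) ≈ p * (x * x)
      pow = begin-equality
        x ^ (2 ℕ.* suc k)      ≡⟨ ≡.cong (x ^_) 2[1+k]≡ ⟩
        x ^ (2 ℕ.+ 2 ℕ.* k)    ≈⟨ ^-homo-* x 2 (2 ℕ.* k) ⟩
        x ^ 2 * p              ≈⟨ *-congʳ (^2≈ x) ⟩
        x * x * p              ≈⟨ *-comm (x * x) p ⟩
        p * (x * x)            ∎

      fact : (2 ℕ.* suc k) ! ≡ m ℕ.* (2 ℕ.* k) !
      fact = ≡.trans (≡.cong _! 2[1+k]≡)
        (≡.sym (ℕₚ.*-assoc (2 ℕ.+ 2 ℕ.* k) (1 ℕ.+ 2 ℕ.* k) ((2 ℕ.* k) !)))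

      k+k≤m : k ℕ.+ k ℕ.≤ m
      k+k≤m = ℕₚ.≤-trans (ℕₚ.≤-reflexive (≡.cong (k ℕ.+_) (≡.sym (ℕₚ.+-identityʳ k))))
        (ℕₚ.≤-trans (ℕₚ.m≤n+m (2 ℕ.* k) 2)
          (ℕₚ.m≤m*n (2 ℕ.+ 2 ℕ.* k) (1 ℕ.+ 2 ℕ.* k)))

      2x²≤c : x * x + x * x ≤ c
      2x²≤c = begin
        x * x + x * x      ≤⟨ +-mono-≤ x²≤k x²≤k ⟩
        fromℕ k + fromℕ k  ≈⟨ ×-homo-+ 1# k k ⟨
        fromℕ (k ℕ.+ k)    ≤⟨ fromℕ-mono-≤ k+k≤m ⟩
        c                  ∎

      b≈ca : b ≈ c * a
      b≈ca = begin-equality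
        b                            ≡⟨ ≡.cong fromℕ fact ⟩
        fromℕ (m ℕ.* (2 ℕ.* k) !)    ≈⟨ ×1-homo-* m ((2 ℕ.* k) !) ⟩
        c * a                        ∎

      a≉0 : ¬ (a ≈ 0#)
      a≉0 = fromℕ-≉0 ((2 ℕ.* k) !) {{ℕₚ._!≢0 (2 ℕ.* k)}}

      b≉0 : ¬ (b ≈ 0#)
      b≉0 = fromℕ-≉0 ((2 ℕ.* suc k) !) {{ℕₚ._!≢0 (2 ℕ.* suc k)}}

      cb⁻¹≈a⁻¹ : c * b ⁻¹ ≈ a ⁻¹
      cb⁻¹≈a⁻¹ = begin-equality
        c * b ⁻¹                ≈⟨ *-identityʳ (c * b ⁻¹) ⟨
        c * b ⁻¹ * 1#           ≈⟨ *-congˡ (⁻¹-inverseʳ a≉0) ⟨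
        c * b ⁻¹ * (a * a ⁻¹)   ≈⟨ *-assoc (c * b ⁻¹) a (a ⁻¹) ⟨
        c * b ⁻¹ * a * a ⁻¹     ≈⟨ *-congʳ (*-assoc c (b ⁻¹) a) ⟩
        c * (b ⁻¹ * a) * a ⁻¹   ≈⟨ *-congʳ (*-congˡ (*-comm (b ⁻¹) a)) ⟩
        c * (a * b ⁻¹) * a ⁻¹   ≈⟨ *-congʳ (*-assoc c a (b ⁻¹)) ⟨
        c * a * b ⁻¹ * a ⁻¹     ≈⟨ *-congʳ (*-congʳ b≈ca) ⟨
        b * b ⁻¹ * a ⁻¹         ≈⟨ *-congʳ (⁻¹-inverseʳ b≉0) ⟩
        1# * a ⁻¹               ≈⟨ *-identityˡ (a ⁻¹) ⟩
        a ⁻¹                    ∎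

  CoshPartialSum : Carrier → Pred Carrier 0ℓ
  CoshPartialSum x s = ∃ λ n → s ≈ coshPartial x n

  coshPartial-bounded : ∀ x → ∃ (IsUpperBound (CoshPartialSum x))
  coshPartial-bounded x with archimedean (x * x)
  ... | N , x²≤N = C , bound
    where
    T = coshTerm x
    S = coshPartial x
    C = S N + (T N + T N)

    tail : ∀ j → S (j ℕ.+ N) + (T (j ℕ.+ N) + T (j ℕ.+ N)) ≤ C
    tail zero    = ≤.refl
    tail (suc j) = begin
      S i + T i + (T (suc i) + T (suc i))
        ≤⟨ +-monoʳ-≤ (S i + T i)
             (halving x i (≤.trans x²≤N (fromℕ-mono-≤ (ℕₚ.m≤n+m N j)))) ⟩
      S i + T i + T i    ≈⟨ +-assoc (S i) (T i) (T i) ⟩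
      S i + (T i + T i)  ≤⟨ tail j ⟩
      C                  ∎
      where i = j ℕ.+ N

    grow : ∀ j n → S n ≤ S (j ℕ.+ n)
    grow zero    n = ≤.refl
    grow (suc j) n = ≤.trans (grow j n) (x≤x+y (coshTerm-nonneg x (j ℕ.+ n)))

    bound : IsUpperBound (CoshPartialSum x) C
    bound s (n , s≈Sn) = begin
      s            ≈⟨ s≈Sn ⟩
      S n          ≤⟨ grow N n ⟩
      S (N ℕ.+ n)  ≡⟨ ≡.cong S (ℕₚ.+-comm N n) ⟩
      S (n ℕ.+ N)  ≤⟨ x≤x+y (+-nonneg (coshTerm-nonneg x (n ℕ.+ N))
                                      (coshTerm-nonneg x (n ℕ.+ N))) ⟩
      S (n ℕ.+ N) + (T (n ℕ.+ N) + T (n ℕ.+ N))  ≤⟨ tail n ⟩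
      C            ∎

  -- The terms x²ᵏ / (2k)! are nonnegative, so the sum of the power series is the
  -- supremum of its partial sums.
  cosh : Carrier → Carrier
  cosh x = ⨆ (CoshPartialSum x) (0# , 0 , R.refl) (coshPartial-bounded x)

  coshPartial≤cosh : ∀ x n → coshPartial x n ≤ cosh x
  coshPartial≤cosh x n =
    proj₁ (⨆-isLeastUpperBound (CoshPartialSum x) _ (coshPartial-bounded x))
      (coshPartial x n) (n , R.refl)

  cosh-least : ∀ x u → (∀ n → coshPartial x n ≤ u) → cosh x ≤ u
  cosh-least x u S≤u =
    proj₂ (⨆-isLeastUpperBound (CoshPartialSum x) _ (coshPartial-bounded x)) u
      (λ s (n , s≈Sn) → ≤.trans (≤.reflexive s≈Sn) (S≤u n))

  private
    1/1≈1 : 1# / fromℕ 1 ≈ 1#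
    1/1≈1 = begin-equality
      1# * fromℕ 1 ⁻¹       ≈⟨ *-congʳ (+-identityʳ 1#) ⟨
      fromℕ 1 * fromℕ 1 ⁻¹  ≈⟨ ⁻¹-inverseʳ (fromℕ-≉0 1) ⟩
      1#                    ∎

  cosh0≤1 : cosh 0# ≤ 1#
  cosh0≤1 = cosh-least 0# 1# S≤1
    where
    0-term : ∀ n → coshTerm 0# (suc n) ≈ 0#
    0-term n = begin-equality
      0# * 0# ^ (n ℕ.+ (suc n ℕ.+ 0)) * fromℕ ((2 ℕ.* suc n) !) ⁻¹
        ≈⟨ *-congʳ (zeroˡ _) ⟩
      0# * fromℕ ((2 ℕ.* suc n) !) ⁻¹
        ≈⟨ zeroˡ _ ⟩
      0# ∎

    S≤1 : ∀ n → coshPartial 0# n ≤ 1#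
    S≤1 zero          = 0≤1
    S≤1 (suc zero)    = ≤.reflexive (R.trans (+-identityˡ _) 1/1≈1)
    S≤1 (suc (suc n)) = begin
      coshPartial 0# (suc n) + coshTerm 0# (suc n)  ≈⟨ +-congˡ (0-term n) ⟩
      coshPartial 0# (suc n) + 0#                   ≈⟨ +-identityʳ _ ⟩
      coshPartial 0# (suc n)                        ≤⟨ S≤1 (suc n) ⟩
      1#                                            ∎

  x≤2cosh : ∀ x → x ≤ cosh x + cosh x
  x≤2cosh x = begin
    x                  ≤⟨ x≤1+x² x ⟩
    1# + x * x         ≤⟨ +-monoˡ-≤ (x * x) (x≤x+y 0≤1) ⟩
    1# + 1# + x * x    ≈⟨ +-congˡ split ⟨
    1# + 1# + (t + t)  ≈⟨ +-assoc 1# 1# (t + t) ⟩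
    1# + (1# + (t + t))  ≈⟨ +-congˡ (+-assoc 1# t t) ⟨
    1# + (1# + t + t)    ≈⟨ +-congˡ (+-comm (1# + t) t) ⟩
    1# + (t + (1# + t))  ≈⟨ +-assoc 1# t (1# + t) ⟨
    1# + t + (1# + t)    ≤⟨ +-mono-≤ 1+t≤cosh 1+t≤cosh ⟩
    cosh x + cosh x      ∎
    where
    t = coshTerm x 1
    h = fromℕ 2 ⁻¹

    split : t + t ≈ x * x
    split = begin-equality
      x ^ 2 * h + x ^ 2 * h  ≈⟨ distribˡ (x ^ 2) h h ⟨
      x ^ 2 * (h + h)        ≈⟨ *-cong (^2≈ x) h+h≈1 ⟩
      x * x * 1#             ≈⟨ *-identityʳ (x * x) ⟩
      x * x                  ∎
      where
      h+h≈1 : h + h ≈ 1#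
      h+h≈1 = begin-equality
        h + h            ≈⟨ +-cong (*-identityˡ h) (*-identityˡ h) ⟨
        1# * h + 1# * h  ≈⟨ distribʳ h 1# 1# ⟨
        (1# + 1#) * h    ≈⟨ *-congʳ (+-congˡ (+-identityʳ 1#)) ⟨
        fromℕ 2 * h      ≈⟨ ⁻¹-inverseʳ (fromℕ-≉0 2) ⟩
        1#               ∎

    1+t≤cosh : 1# + t ≤ cosh x
    1+t≤cosh = begin
      1# + t                      ≈⟨ +-congʳ (R.trans (+-identityˡ _) 1/1≈1) ⟨
      0# + 1# / fromℕ 1 + t       ≤⟨ coshPartial≤cosh x 2 ⟩
      cosh x                      ∎

  -- cosh 0 = 1 and cosh is continuous, unbounded and strictly increasing on
  -- [0,∞), so this is the unique d ≥ 0 with cosh d = t.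
  arcosh : ∀ t → 1# ≤ t → Carrier
  arcosh t 1≤t = ⨆ (λ x → 0# ≤ x × cosh x ≤ t)
    (0# , ≤.refl , ≤.trans cosh0≤1 1≤t)
    (t + t , λ x (_ , coshx≤t) → ≤.trans (x≤2cosh x) (+-mono-≤ coshx≤t coshx≤t))

  record Euclidean² : Set where
    constructor _,_
    field
      x y : Carrier

  sqDist : (a b c d : Carrier) → Carrier
  sqDist a b c d = (a - c) * (a - c) + (b - d) * (b - d)

  sqDist-nonneg : ∀ a b c d → 0# ≤ sqDist a b c d
  sqDist-nonneg a b c d = +-nonneg (square-nonneg (a - c)) (square-nonneg (b - d))

  distE : Euclidean² → Euclidean² → Carrier
  distE (a , b) (c , d) = sqrt (sqDist a b c d) (sqDist-nonneg a b c d)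

  -- Poincaré's upper half-plane {(x , y) ∣ y > 0} with the metric
  -- (dx² + dy²) / y² of curvature −1, whose distance function is determined by
  -- cosh d(p,q) = 1 + ∥p − q∥² / (2 y(p) y(q)), with ∥_∥ the Euclidean norm.
  record ℍ² : Set where
    field
      x y : Carrier
      0<y : 0# < y

  coshDistH : ℍ² → ℍ² → Carrier
  coshDistH p q = 1# + sqDist p.x p.y q.x q.y / (fromℕ 2 * (p.y * q.y))
    where
    module p = ℍ² p
    module q = ℍ² q

  1≤coshDistH : ∀ p q → 1# ≤ coshDistH p q
  1≤coshDistH p q =
    x≤x+y (*-nonneg (sqDist-nonneg p.x p.y q.x q.y)
      (⁻¹-nonneg (*-nonneg (fromℕ-nonneg 2)
        (*-nonneg (proj₁ p.0<y) (proj₁ q.0<y)))))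
    where
    module p = ℍ² p
    module q = ℍ² q

  distH : ℍ² → ℍ² → Carrier
  distH p q = arcosh (coshDistH p q) (1≤coshDistH p q)

record Graph (n : ℕ) : Set₁ where
  field
    Adjacent    : Rel (Fin n) 0ℓ
    symmetric   : Symmetric Adjacent
    irreflexive : ∀ v → ¬ Adjacent v v

module _ (ℝ : CompleteOrderedField) where

  open CompleteOrderedField ℝ
  open Analysis ℝ

  IsUnitDiskGraph : {X : Set} (dist : X → X → Carrier) {n : ℕ} → Graph n → Set
  IsUnitDiskGraph {X} dist {n} G =
    ∃ λ (φ : Fin n → X) → ∃ λ (R : Carrier) → 0# < R ×
    (∀ u v → u ≢ v → Graph.Adjacent G u v ⇔ dist (φ u) (φ v) ≤ R)

  IsEuclideanUnitDiskGraph : {n : ℕ} → Graph n → Set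
  IsEuclideanUnitDiskGraph = IsUnitDiskGraph distE

  IsHyperbolicUnitDiskGraph : {n : ℕ} → Graph n → Set
  IsHyperbolicUnitDiskGraph = IsUnitDiskGraph distH

{-# OPTIONS --safe #-}

-- Scale the points into a small neighbourhood of a point of the upper half-plane
-- at height 1: (a , b) goes to (εa , 1 + ε(b + B)), with B making b + B ≥ 0.
-- There cosh d = 1 + ε²D / (2P), where D is the squared Euclidean distance and
-- P ≥ 1 the product of the heights.  With the threshold εR, the bound
-- 1 + x²/2 ≤ cosh x shows that D ≤ R² gives d ≤ εR.  If D > R², then for small ε
-- the bound cosh x ≤ 1 + x²(1 + x²)/2 shows that even εR(1 + ε) ≤ d.  There are
-- finitely many pairs, so one ε serves them all.
module Submission where

open import Defs
open import Data.Nat.Base as ℕ using (ℕ; zero; suc; _!)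
import Algebra.Properties.AbelianGroup as AbelianGroupProperties
import Algebra.Properties.Ring as RingProperties
import Algebra.Properties.Semiring.Mult as SemiringMult
import Algebra.Solver.Ring.NaturalCoefficients.Default as SemiringSolver
open import Data.Fin.Base using (Fin; zero; suc)
import Data.Nat.Properties as ℕₚ
open import Data.Product.Base using (∃; _×_; _,_; proj₁; proj₂)
open import Data.Sum.Base using (inj₁; inj₂)
open import Function.Base using (_∘_)
open import Function.Bundles using (mk⇔; module Equivalence)
import Relation.Binary.Construct.NonStrictToStrict as ToStrict
import Relation.Binary.PropositionalEquality.Core as ≡
import Relation.Binary.Reasoning.PartialOrder as PartialOrderReasoning
open import Relation.Binary.Structures using (IsDecTotalOrder)
open import Relation.Nullary using (¬_; yes; no)
open import Relation.Nullary.Decidable using (decidable-stable)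

module _ (ℝ : CompleteOrderedField) where

  open CompleteOrderedField ℝ hiding (zero)
  open Analysis ℝ
  private
    module ≤ = IsDecTotalOrder isDecTotalOrder
    module < = ToStrict _≈_ _≤_
    open AbelianGroupProperties +-abelianGroup using (xyx⁻¹≈y)
    open RingProperties ring using (x[y-z]≈xy-xz)
    open SemiringMult semiring using (×1-homo-*)
    open SemiringSolver commutativeSemiring
      using (solve; con; _:+_; _:*_; _:=_)

  open PartialOrderReasoning poset

  -- Arithmetic in an ordered field.

  <-≤-trans : ∀ {x y z} → x < y → y ≤ z → x < z
  <-≤-trans = <.<-≤-trans sym ≤.trans ≤.antisym ≤.≤-respʳ-≈

  0<1 : 0# < 1#
  0<1 = 0≤1 , 1≉0 ∘ sym

  <⇒≉0 : ∀ {x} → 0# < x → ¬ (x ≈ 0#)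
  <⇒≉0 (_ , 0≉x) x≈0 = 0≉x (sym x≈0)

  0<1+x : ∀ {x} → 0# ≤ x → 0# < 1# + x
  0<1+x 0≤x = <-≤-trans 0<1 (x≤x+y 0≤x)

  *-mono-≤ : ∀ {x y u v} → 0# ≤ y → 0# ≤ u → x ≤ y → u ≤ v → x * u ≤ y * v
  *-mono-≤ 0≤y 0≤u x≤y u≤v = ≤.trans (*-monoʳ-≤ 0≤u x≤y) (*-monoˡ-≤ 0≤y u≤v)

  x≤x*y : ∀ {x y} → 0# ≤ x → 1# ≤ y → x ≤ x * y
  x≤x*y {x} {y} 0≤x 1≤y = begin
    x       ≈⟨ *-identityʳ x ⟨
    x * 1#  ≤⟨ *-monoˡ-≤ 0≤x 1≤y ⟩
    x * y   ∎

  x-y+y≈x : ∀ x y → x - y + y ≈ x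
  x-y+y≈x x y = begin-equality
    x - y + y      ≈⟨ +-assoc x (- y) y ⟩
    x + (- y + y)  ≈⟨ +-congˡ (-‿inverseˡ y) ⟩
    x + 0#         ≈⟨ +-identityʳ x ⟩
    x              ∎

  x≈z+y⇒x-y≈z : ∀ {x y z} → x ≈ z + y → x - y ≈ z
  x≈z+y⇒x-y≈z {x} {y} {z} x≈z+y = begin-equality
    x - y      ≈⟨ +-congʳ (trans x≈z+y (+-comm z y)) ⟩
    y + z - y  ≈⟨ xyx⁻¹≈y y z ⟩
    z          ∎

  +-cancelʳ-≤ : ∀ z {x y} → x + z ≤ y + z → x ≤ y
  +-cancelʳ-≤ z {x} {y} x+z≤y+z = begin
    x          ≈⟨ x≈z+y⇒x-y≈z refl ⟨
    x + z - z  ≤⟨ +-monoˡ-≤ (- z) x+z≤y+z ⟩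
    y + z - z  ≈⟨ x≈z+y⇒x-y≈z refl ⟩
    y          ∎

  x≤y⇒0≤y-x : ∀ {x y} → x ≤ y → 0# ≤ y - x
  x≤y⇒0≤y-x {x} {y} x≤y = begin
    0#     ≈⟨ -‿inverseʳ x ⟨
    x - x  ≤⟨ +-monoˡ-≤ (- x) x≤y ⟩
    y - x  ∎

  x<y⇒0<y-x : ∀ {x y} → x < y → 0# < y - x
  x<y⇒0<y-x {x} {y} (x≤y , x≉y) = x≤y⇒0≤y-x x≤y , λ 0≈y-x → x≉y (begin-equality
    x          ≈⟨ +-identityˡ x ⟨
    0# + x     ≈⟨ +-congʳ 0≈y-x ⟩
    y - x + x  ≈⟨ x-y+y≈x y x ⟩
    y          ∎)

  x*y*y⁻¹≈x : ∀ x {y} → 0# < y → x * y * y ⁻¹ ≈ x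
  x*y*y⁻¹≈x x {y} 0<y = begin-equality
    x * y * y ⁻¹    ≈⟨ *-assoc x y (y ⁻¹) ⟩
    x * (y * y ⁻¹)  ≈⟨ *-congˡ (⁻¹-inverseʳ (<⇒≉0 0<y)) ⟩
    x * 1#          ≈⟨ *-identityʳ x ⟩
    x               ∎

  *-cancelʳ-≤ : ∀ {z x y} → 0# < z → x * z ≤ y * z → x ≤ y
  *-cancelʳ-≤ {z} {x} {y} 0<z xz≤yz = begin
    x             ≈⟨ x*y*y⁻¹≈x x 0<z ⟨
    x * z * z ⁻¹  ≤⟨ *-monoʳ-≤ (⁻¹-nonneg (proj₁ 0<z)) xz≤yz ⟩
    y * z * z ⁻¹  ≈⟨ x*y*y⁻¹≈x y 0<z ⟩
    y             ∎

  *-pos : ∀ {x y} → 0# < x → 0# < y → 0# < x * y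
  *-pos {x} {y} 0<x 0<y = *-nonneg (proj₁ 0<x) (proj₁ 0<y) , λ 0≈xy → proj₂ 0<x (begin-equality
    0#            ≈⟨ zeroˡ (y ⁻¹) ⟨
    0# * y ⁻¹     ≈⟨ *-congʳ 0≈xy ⟩
    x * y * y ⁻¹  ≈⟨ x*y*y⁻¹≈x x 0<y ⟩
    x             ∎)

  ⁻¹-pos : ∀ {x} → 0# < x → 0# < x ⁻¹
  ⁻¹-pos {x} 0<x = ⁻¹-nonneg (proj₁ 0<x) , λ 0≈x⁻¹ → 1≉0 (begin-equality
    1#        ≈⟨ ⁻¹-inverseʳ (<⇒≉0 0<x) ⟨
    x * x ⁻¹  ≈⟨ *-congˡ 0≈x⁻¹ ⟨
    x * 0#    ≈⟨ zeroʳ x ⟩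
    0#        ∎)

  x≤y*z⇒x/z≤y : ∀ {x y z} → 0# < z → x ≤ y * z → x / z ≤ y
  x≤y*z⇒x/z≤y {x} {y} {z} 0<z x≤yz = begin
    x / z       ≤⟨ *-monoʳ-≤ (⁻¹-nonneg (proj₁ 0<z)) x≤yz ⟩
    y * z / z   ≈⟨ x*y*y⁻¹≈x y 0<z ⟩
    y           ∎

  y*z≤x⇒y≤x/z : ∀ {x y z} → 0# < z → y * z ≤ x → y ≤ x / z
  y*z≤x⇒y≤x/z {x} {y} {z} 0<z yz≤x = begin
    y           ≈⟨ x*y*y⁻¹≈x y 0<z ⟨
    y * z / z   ≤⟨ *-monoʳ-≤ (⁻¹-nonneg (proj₁ 0<z)) yz≤x ⟩
    x / z       ∎

  -- If `y ≤ x` with `x` nonzero, then x² ≤ y² ≤ yx, and a factor `x` cancels.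
  square-cancel-≤ : ∀ {x y} → 0# ≤ y → x * x ≤ y * y → x ≤ y
  square-cancel-≤ {x} {y} 0≤y x²≤y² with ≤.total x y | x ≤.≟ 0#
  ... | inj₁ x≤y | _       = x≤y
  ... | inj₂ y≤x | yes x≈0 = ≤.trans (≤.reflexive x≈0) 0≤y
  ... | inj₂ y≤x | no x≉0  =
    *-cancelʳ-≤ (≤.trans 0≤y y≤x , x≉0 ∘ sym) (≤.trans x²≤y² (*-monoˡ-≤ 0≤y y≤x))

  -- The difference of the two sides is (x - y)². The solver works over semirings, so `x` is
  -- replaced by `d + y` to keep subtraction out of the identity.
  4xy≤[x+y]² : ∀ x y → fromℕ 4 * (x * y) ≤ (x + y) * (x + y)
  4xy≤[x+y]² x y = begin
    fromℕ 4 * (x * y)                      ≈⟨ *-congˡ (*-congʳ d+y≈x) ⟨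
    fromℕ 4 * ((d + y) * y)                ≤⟨ x≤x+y (square-nonneg d) ⟩
    fromℕ 4 * ((d + y) * y) + d * d        ≈⟨ expand d y ⟩
    (d + y + y) * (d + y + y)              ≈⟨ *-cong (+-congʳ d+y≈x) (+-congʳ d+y≈x) ⟩
    (x + y) * (x + y)                      ∎
    where
    d = x - y

    d+y≈x : d + y ≈ x
    d+y≈x = x-y+y≈x x y

    expand : ∀ d y → fromℕ 4 * ((d + y) * y) + d * d ≈ (d + y + y) * (d + y + y)
    expand = solve 2 (λ d y → four :* ((d :+ y) :* y) :+ d :* d
                           := (d :+ y :+ y) :* (d :+ y :+ y)) refl
      -- `four` repeats the unfolding of `fromℕ 4`, so that the solved equation agrees with the
      -- stated one by computation.
      where four = con 1 :+ (con 1 :+ (con 1 :+ (con 1 :+ con 0)))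

  -- Bounds for finite families and for powers of 1 + x.

  -- The sum of the nonnegative values serves as the bound, in place of a maximum.
  finite-bounded : ∀ {n} (f : Fin n → Carrier) →
                   ∃ λ B → 0# ≤ B × (∀ i → f i ≤ B)
  finite-bounded {zero}  f = 0# , ≤.refl , λ ()
  finite-bounded {suc n} f with finite-bounded (f ∘ suc) | ≤.total 0# (f zero)
  ... | B , 0≤B , f≤B | inj₁ 0≤f₀ = f zero + B , +-nonneg 0≤f₀ 0≤B , λ where
    zero    → x≤x+y 0≤B
    (suc i) → ≤.trans (f≤B i) (≤.trans (x≤x+y 0≤f₀) (≤.reflexive (+-comm B (f zero))))
  ... | B , 0≤B , f≤B | inj₂ f₀≤0 = B , 0≤B , λ where
    zero    → ≤.trans f₀≤0 0≤B
    (suc i) → f≤B i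

  -- For 0 ≤ x ≤ 1 the quadratic term m x² is at most m x, so `m` becomes 1 + 2m at each step. It
  -- does not depend on `x`, which lets the scale ε be chosen after it.
  [1+x]^n≤1+mx : ∀ n → ∃ λ m → 0# ≤ m ×
                 (∀ {x} → 0# ≤ x → x ≤ 1# → (1# + x) ^ n ≤ 1# + m * x)
  [1+x]^n≤1+mx zero    = 0# , ≤.refl , λ {x} _ _ →
    ≤.reflexive (sym (trans (+-congˡ (zeroˡ x)) (+-identityʳ 1#)))
  [1+x]^n≤1+mx (suc n) with [1+x]^n≤1+mx n
  ... | m , 0≤m , bound = 1# + m + m , +-nonneg (+-nonneg 0≤1 0≤m) 0≤m ,
    λ {x} 0≤x x≤1 → begin
      (1# + x) * (1# + x) ^ n          ≤⟨ *-monoˡ-≤ (+-nonneg 0≤1 0≤x) (bound 0≤x x≤1) ⟩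
      (1# + x) * (1# + m * x)          ≈⟨ expand m x ⟩
      1# + (1# + m) * x + m * x * x    ≤⟨ +-monoʳ-≤ _ (*-monoˡ-≤ (*-nonneg 0≤m 0≤x) x≤1) ⟩
      1# + (1# + m) * x + m * x * 1#   ≈⟨ collect m x ⟩
      1# + (1# + m + m) * x            ∎
    where
    expand : ∀ m x → (1# + x) * (1# + m * x) ≈ 1# + (1# + m) * x + m * x * x
    expand = solve 2 (λ m x → (con 1 :+ x) :* (con 1 :+ m :* x)
                           := con 1 :+ (con 1 :+ m) :* x :+ m :* x :* x) refl

    collect : ∀ m x → 1# + (1# + m) * x + m * x * 1# ≈ 1# + (1# + m + m) * x
    collect = solve 2 (λ m x → con 1 :+ (con 1 :+ m) :* x :+ m :* x :* con 1
                            := con 1 :+ (con 1 :+ m :+ m) :* x) refl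

  -- Square roots as suprema.

  -- The root is given as a supremum, so a single test point `x` of the set is used: `x ≤ r` clears
  -- to 2a ≤ a + r² after cancelling `r`.
  sqrt≤⇒≤square : ∀ {a r} {0≤a : 0# ≤ a} → 0# < r → sqrt a 0≤a ≤ r → a ≤ r * r
  sqrt≤⇒≤square {a} {r} {0≤a} 0<r √a≤r =
    +-cancelʳ-≤ a (≤.trans (*-cancelʳ-≤ 0<r 2ar≤rs) (≤.reflexive (+-comm a (r * r))))
    where
    -- For a > r² the harmonic mean x of r and a / r lies between r and √a.
    s = a + r * r
    x = (a + a) * r / s

    0<s : 0# < s
    0<s = <-≤-trans (*-pos 0<r 0<r)
      (≤.trans (x≤x+y 0≤a) (≤.reflexive (+-comm (r * r) a)))

    -- Here x² = 4a²r² / s², and 4ar² ≤ s² is the inequality of arithmetic and geometric means for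
    -- `a` and `r * r`.
    x²≤a : x * x ≤ a
    x²≤a = begin
      x * x                                  ≈⟨ regroup a r (s ⁻¹) ⟩
      a * (fromℕ 4 * (a * (r * r))) / s / s
        ≤⟨ *-monoʳ-≤ 0≤s⁻¹ (*-monoʳ-≤ 0≤s⁻¹ (*-monoˡ-≤ 0≤a (4xy≤[x+y]² a (r * r)))) ⟩
      a * (s * s) / s / s                    ≈⟨ *-congʳ (*-congʳ (*-assoc a s s)) ⟨
      a * s * s / s / s                      ≈⟨ *-congʳ (x*y*y⁻¹≈x (a * s) 0<s) ⟩
      a * s / s                              ≈⟨ x*y*y⁻¹≈x a 0<s ⟩
      a                                      ∎
      where
      0≤s⁻¹ = ⁻¹-nonneg (proj₁ 0<s)

      regroup : ∀ a r i → (a + a) * r * i * ((a + a) * r * i) ≈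
                          a * (fromℕ 4 * (a * (r * r))) * i * i
      regroup = solve 3 (λ a r i → (a :+ a) :* r :* i :* ((a :+ a) :* r :* i)
                  := a :* (four :* (a :* (r :* r))) :* i :* i) refl
        where four = con 1 :+ (con 1 :+ (con 1 :+ (con 1 :+ con 0)))

    0≤x : 0# ≤ x
    0≤x = *-nonneg (*-nonneg (+-nonneg 0≤a 0≤a) (proj₁ 0<r)) (⁻¹-nonneg (proj₁ 0<s))

    2ar≤rs : (a + a) * r ≤ s * r
    2ar≤rs = *-cancelʳ-≤ (⁻¹-pos 0<s) (begin
      x               ≤⟨ proj₁ (⨆-isLeastUpperBound _ _ _) x (0≤x , x²≤a) ⟩
      sqrt a 0≤a      ≤⟨ √a≤r ⟩
      r               ≈⟨ x*y*y⁻¹≈x r 0<s ⟨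
      r * s / s       ≈⟨ *-congʳ (*-comm r s) ⟩
      s * r / s       ∎)

  ≤square⇒sqrt≤ : ∀ {a r} {0≤a : 0# ≤ a} → 0# ≤ r → a ≤ r * r → sqrt a 0≤a ≤ r
  ≤square⇒sqrt≤ 0≤r a≤r² = proj₂ (⨆-isLeastUpperBound _ _ _) _
    (λ x (_ , x²≤a) → square-cancel-≤ 0≤r (≤.trans x²≤a a≤r²))

  -- Bounds for cosh and arcosh.

  ½ : Carrier
  ½ = fromℕ 2 ⁻¹

  ^-even-suc : ∀ x k → x ^ (2 ℕ.* suc k) ≈ x * x * x ^ (2 ℕ.* k)
  ^-even-suc x k = begin-equality
    x ^ (2 ℕ.* suc k)          ≡⟨ ≡.cong (x ^_) (ℕₚ.*-suc 2 k) ⟩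
    x * (x * x ^ (2 ℕ.* k))    ≈⟨ *-assoc x x _ ⟨
    x * x * x ^ (2 ℕ.* k)      ∎

  ^-even-nonneg : ∀ x k → 0# ≤ x ^ (2 ℕ.* k)
  ^-even-nonneg x zero    = 0≤1
  ^-even-nonneg x (suc k) = ≤.trans (*-nonneg (square-nonneg x) (^-even-nonneg x k))
    (≤.reflexive (sym (^-even-suc x k)))

  x+x≤y⇒y⁻¹+y⁻¹≤x⁻¹ : ∀ {x y} → 0# < x → 0# < y → x + x ≤ y → y ⁻¹ + y ⁻¹ ≤ x ⁻¹
  x+x≤y⇒y⁻¹+y⁻¹≤x⁻¹ {x} {y} 0<x 0<y x+x≤y = begin
    y ⁻¹ + y ⁻¹                        ≈⟨ +-cong (x*y*y⁻¹≈x _ 0<x) (x*y*y⁻¹≈x _ 0<x) ⟨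
    y ⁻¹ * x * x ⁻¹ + y ⁻¹ * x * x ⁻¹  ≈⟨ regroup x (x ⁻¹) (y ⁻¹) ⟩
    x ⁻¹ * (x + x) / y                 ≤⟨ *-monoʳ-≤ (⁻¹-nonneg (proj₁ 0<y))
                                            (*-monoˡ-≤ (⁻¹-nonneg (proj₁ 0<x)) x+x≤y) ⟩
    x ⁻¹ * y / y                       ≈⟨ x*y*y⁻¹≈x _ 0<y ⟩
    x ⁻¹                               ∎
    where
    regroup : ∀ x i j → j * x * i + j * x * i ≈ i * (x + x) * j
    regroup = solve 3 (λ x i j → j :* x :* i :+ j :* x :* i := i :* (x :+ x) :* j) refl

  fromℕ-!-pos : ∀ n → 0# < fromℕ (n !)
  fromℕ-!-pos n = fromℕ-nonneg (n !) , fromℕ-≉0 (n !) {{ℕₚ._!≢0 n}} ∘ sym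

  -- This rests on 2 (2k)! ≤ (2k + 2)!. Keeping the factor `x * x` serves twice: at k = 1 it
  -- produces the term x⁴/2 of the upper bound for cosh, and for x² ≤ 1 it makes the later terms at
  -- least halve.
  coshTerm-suc : ∀ x k → coshTerm x (suc k) + coshTerm x (suc k) ≤ x * x * coshTerm x k
  coshTerm-suc x k = begin
    x ^ (2 ℕ.* suc k) / b + x ^ (2 ℕ.* suc k) / b   ≈⟨ distribˡ _ (b ⁻¹) (b ⁻¹) ⟨
    x ^ (2 ℕ.* suc k) * (b ⁻¹ + b ⁻¹)               ≤⟨ *-monoˡ-≤ (^-even-nonneg x (suc k))
      (x+x≤y⇒y⁻¹+y⁻¹≤x⁻¹ (fromℕ-!-pos (2 ℕ.* k)) (fromℕ-!-pos (2 ℕ.* suc k)) 2a≤b) ⟩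
    x ^ (2 ℕ.* suc k) / a                           ≈⟨ *-congʳ (^-even-suc x k) ⟩
    x * x * x ^ (2 ℕ.* k) / a                       ≈⟨ *-assoc (x * x) _ (a ⁻¹) ⟩
    x * x * coshTerm x k                            ∎
    where
    a = fromℕ ((2 ℕ.* k) !)
    b = fromℕ ((2 ℕ.* suc k) !)

    2[2k]!≤[2k+2]! : 2 ℕ.* (2 ℕ.* k) ! ℕ.≤ (2 ℕ.* suc k) !
    2[2k]!≤[2k+2]! = ℕₚ.≤-trans
      (ℕₚ.*-mono-≤ (ℕₚ.m≤m+n 2 (2 ℕ.* k)) (ℕₚ.m≤n*m ((2 ℕ.* k) !) (1 ℕ.+ 2 ℕ.* k)))
      (ℕₚ.≤-reflexive (≡.cong _! (≡.sym (ℕₚ.*-suc 2 k))))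

    2a≤b : a + a ≤ b
    2a≤b = begin
      a + a                          ≈⟨ solve 1 (λ a → a :+ a
                                          := (con 1 :+ (con 1 :+ con 0)) :* a) refl a ⟩
      fromℕ 2 * a                    ≈⟨ ×1-homo-* 2 ((2 ℕ.* k) !) ⟨
      fromℕ (2 ℕ.* (2 ℕ.* k) !)      ≤⟨ fromℕ-mono-≤ 2[2k]!≤[2k+2]! ⟩
      b                              ∎

  coshPartial-2 : ∀ x → coshPartial x 2 ≈ 1# + x * x * ½
  coshPartial-2 x = +-cong (begin-equality
    0# + 1# / fromℕ 1     ≈⟨ +-identityˡ _ ⟩
    1# / fromℕ 1          ≈⟨ *-congʳ (+-identityʳ 1#) ⟨
    fromℕ 1 / fromℕ 1     ≈⟨ ⁻¹-inverseʳ (fromℕ-≉0 1) ⟩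
    1#                    ∎) (*-congʳ (*-congˡ (*-identityʳ x)))

  1+½x²≤cosh : ∀ x → 1# + x * x * ½ ≤ cosh x
  1+½x²≤cosh x = ≤.trans (≤.reflexive (sym (coshPartial-2 x))) (coshPartial≤cosh x 2)

  -- When x² ≤ 1 each new term is at most half of the one before, so S i + 2 T i does not increase
  -- from i = 2 on and bounds the partial sums; at i = 2 it is at most 1 + x²/2 + x⁴/2.
  cosh≤1+½x²[1+x²] : ∀ {x} → x * x ≤ 1# → cosh x ≤ 1# + x * x * (1# + x * x) * ½
  cosh≤1+½x²[1+x²] {x} x²≤1 = cosh-least x _ λ n → begin
    -- `tail` starts at index 2, so the partial sum is first extended by two terms.
    S n                                 ≤⟨ x≤x+y (T-nonneg n) ⟩
    S (1 ℕ.+ n)                         ≤⟨ x≤x+y (T-nonneg (1 ℕ.+ n)) ⟩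
    S (2 ℕ.+ n)                         ≤⟨ x≤x+y (+-nonneg (T-nonneg (2 ℕ.+ n)) (T-nonneg (2 ℕ.+ n))) ⟩
    S (2 ℕ.+ n) + (T (2 ℕ.+ n) + T (2 ℕ.+ n))  ≤⟨ tail n ⟩
    1# + x * x * (1# + x * x) * ½       ∎
    where
    T = coshTerm x
    S = coshPartial x
    T-nonneg = coshTerm-nonneg x

    tail : ∀ n → S (2 ℕ.+ n) + (T (2 ℕ.+ n) + T (2 ℕ.+ n)) ≤
                 1# + x * x * (1# + x * x) * ½
    tail zero = begin
      S 2 + (T 2 + T 2)                  ≤⟨ +-monoʳ-≤ (S 2) (coshTerm-suc x 1) ⟩
      S 2 + x * x * T 1                  ≈⟨ +-cong (coshPartial-2 x)
                                              (*-congˡ (*-congʳ (*-congˡ (*-identityʳ x)))) ⟩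
      1# + x * x * ½ + x * x * (x * x * ½)
        ≈⟨ solve 2 (λ y h → con 1 :+ y :* h :+ y :* (y :* h)
                         := con 1 :+ y :* (con 1 :+ y) :* h) refl (x * x) ½ ⟩
      1# + x * x * (1# + x * x) * ½      ∎
    tail (suc n) = begin
      S i + T i + (T (suc i) + T (suc i))  ≤⟨ +-monoʳ-≤ _ (coshTerm-suc x i) ⟩
      S i + T i + x * x * T i              ≤⟨ +-monoʳ-≤ _ (*-monoʳ-≤ (T-nonneg i) x²≤1) ⟩
      S i + T i + 1# * T i                 ≈⟨ +-congˡ (*-identityˡ (T i)) ⟩
      S i + T i + T i                      ≈⟨ +-assoc (S i) (T i) (T i) ⟩
      S i + (T i + T i)                    ≤⟨ tail n ⟩
      1# + x * x * (1# + x * x) * ½        ∎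
      where i = 2 ℕ.+ n

  ½-cancel-≤ : ∀ {x y} → 1# + x * ½ ≤ 1# + y * ½ → x ≤ y
  ½-cancel-≤ {x} {y} le = *-cancelʳ-≤ (⁻¹-pos 0<2) (+-cancelʳ-≤ 1# (begin
    x * ½ + 1#  ≈⟨ +-comm (x * ½) 1# ⟩
    1# + x * ½  ≤⟨ le ⟩
    1# + y * ½  ≈⟨ +-comm 1# (y * ½) ⟩
    y * ½ + 1#  ∎))
    where
    0<2 : 0# < fromℕ 2
    0<2 = 0<1+x (fromℕ-nonneg 1)

  -- Every `x` in the set whose supremum is `arcosh t` satisfies 1 + x²/2 ≤ cosh x ≤ t ≤ 1 + c²/2,
  -- hence x ≤ c.
  arcosh≤ : ∀ {t c} {1≤t : 1# ≤ t} → 0# ≤ c → t ≤ 1# + c * c * ½ → arcosh t 1≤t ≤ c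
  arcosh≤ 0≤c t≤ = proj₂ (⨆-isLeastUpperBound _ _ _) _
    (λ x (_ , coshx≤t) → square-cancel-≤ 0≤c
      (½-cancel-≤ (≤.trans (1+½x²≤cosh x) (≤.trans coshx≤t t≤))))

  -- The upper bound for cosh puts `c` itself into the set whose supremum is `arcosh t`.
  ≤arcosh : ∀ {t c} {1≤t : 1# ≤ t} → 0# ≤ c → c * c ≤ 1# →
            1# + c * c * (1# + c * c) * ½ ≤ t → c ≤ arcosh t 1≤t
  ≤arcosh 0≤c c²≤1 ≤t = proj₁ (⨆-isLeastUpperBound _ _ _) _
    (0≤c , ≤.trans (cosh≤1+½x²[1+x²] c²≤1) ≤t)

  -- Hyperbolic distances in the half-plane.

  module _ (p q : ℍ²) where
    private
      module p = ℍ² p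
      module q = ℍ² q
      D = sqDist p.x p.y q.x q.y
      P = p.y * q.y

      0<2P : 0# < fromℕ 2 * P
      0<2P = *-pos (0<1+x (fromℕ-nonneg 1)) (*-pos p.0<y q.0<y)

      w½2P≈wP : ∀ w → w * ½ * (fromℕ 2 * P) ≈ w * P
      w½2P≈wP w = begin-equality
        w * ½ * (fromℕ 2 * P)    ≈⟨ *-assoc (w * ½) (fromℕ 2) P ⟨
        w * ½ * fromℕ 2 * P      ≈⟨ *-congʳ (*-assoc w ½ (fromℕ 2)) ⟩
        w * (½ * fromℕ 2) * P    ≈⟨ *-congʳ (*-congˡ (*-comm ½ (fromℕ 2))) ⟩
        w * (fromℕ 2 * ½) * P    ≈⟨ *-congʳ (*-congˡ (⁻¹-inverseʳ (fromℕ-≉0 2))) ⟩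
        w * 1# * P               ≈⟨ *-congʳ (*-identityʳ w) ⟩
        w * P                    ∎

    -- This bound and the next bring cosh of the distance into the shape that `arcosh≤` and
    -- `≤arcosh` ask for, with `w` equal to c² or to c²(1 + c²).
    coshDistH≤ : ∀ {w} → D ≤ w * P → coshDistH p q ≤ 1# + w * ½
    coshDistH≤ {w} D≤wP = +-monoʳ-≤ 1#
      (x≤y*z⇒x/z≤y 0<2P (≤.trans D≤wP (≤.reflexive (sym (w½2P≈wP w)))))

    ≤coshDistH : ∀ {w} → w * P ≤ D → 1# + w * ½ ≤ coshDistH p q
    ≤coshDistH {w} wP≤D = +-monoʳ-≤ 1#
      (y*z≤x⇒y≤x/z 0<2P (≤.trans (≤.reflexive (w½2P≈wP w)) wP≤D))

  sqDist-cong : ∀ {a b c d x y} → a - c ≈ x → b - d ≈ y → sqDist a b c d ≈ x * x + y * y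
  sqDist-cong p q = +-cong (*-cong p p) (*-cong q q)

  -- The shift by `s` and the summand 1 cancel in the differences, and ε factors out of each.
  sqDist-scale : ∀ ε s a b c d →
    sqDist (ε * a) (1# + ε * (b + s)) (ε * c) (1# + ε * (d + s)) ≈ ε * ε * sqDist a b c d
  sqDist-scale ε s a b c d = begin-equality
    sqDist (ε * a) (1# + ε * (b + s)) (ε * c) (1# + ε * (d + s))
      ≈⟨ sqDist-cong (sym (x[y-z]≈xy-xz ε a c)) (x≈z+y⇒x-y≈z heights) ⟩
    ε * (a - c) * (ε * (a - c)) + ε * (b - d) * (ε * (b - d))
      ≈⟨ solve 3 (λ e x y → e :* x :* (e :* x) :+ e :* y :* (e :* y)
                         := e :* e :* (x :* x :+ y :* y)) refl ε (a - c) (b - d) ⟩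
    ε * ε * sqDist a b c d ∎
    where
    -- Subtraction is outside the solver's reach, so `b` is split as (b - d) + d with `b - d` as an
    -- atom.
    heights : 1# + ε * (b + s) ≈ ε * (b - d) + (1# + ε * (d + s))
    heights = begin-equality
      1# + ε * (b + s)                    ≈⟨ +-congˡ (*-congˡ (+-congʳ (x-y+y≈x b d))) ⟨
      1# + ε * (b - d + d + s)            ≈⟨ solve 4 (λ e x d s →
        con 1 :+ e :* (x :+ d :+ s) := e :* x :+ (con 1 :+ e :* (d :+ s))) refl ε (b - d) d s ⟩
      ε * (b - d) + (1# + ε * (d + s))    ∎

  -- The scale of the embedding.

  module Embedding {n} (φ : Fin n → Euclidean²) (R : Carrier) (0<R : 0# < R) where

    open Euclidean² renaming (x to abscissa; y to ordinate)

    D : Fin n → Fin n → Carrier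
    D u v = sqDist (abscissa (φ u)) (ordinate (φ u)) (abscissa (φ v)) (ordinate (φ v))

    r² = R * R

    private
      0≤r² : 0# ≤ r²
      0≤r² = square-nonneg R

      -- Wherever D u v > r², the bound says that 1 / H ≤ D u v − r².
      inverse-gaps : ∃ λ H → 0# ≤ H × (∀ u v → (D u v - r²) ⁻¹ ≤ H)
      -- All pairs enter, also those at distance at most R: `_⁻¹` is total, with value 0 at 0. Rows
      -- are bounded first, then the row bounds.
      inverse-gaps with finite-bounded (λ u → proj₁ (finite-bounded (λ v → (D u v - r²) ⁻¹)))
      ... | H , 0≤H , rows≤H = H , 0≤H , λ u v →
        ≤.trans (proj₂ (proj₂ (finite-bounded (λ w → (D u w - r²) ⁻¹))) v) (rows≤H u)

      H = proj₁ inverse-gaps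
      0≤H = proj₁ (proj₂ inverse-gaps)
      gap⁻¹≤H = proj₂ (proj₂ inverse-gaps)

      -- `B` becomes the vertical shift; `A + B` then bounds all shifted ordinates.
      above = finite-bounded (λ u → ordinate (φ u))
      below = finite-bounded (λ u → - ordinate (φ u))

      A = proj₁ above
      B = proj₁ below
      0≤A = proj₁ (proj₂ above)
      0≤B = proj₁ (proj₂ below)

      0≤b+B : ∀ u → 0# ≤ ordinate (φ u) + B
      0≤b+B u = begin
        0#                                  ≈⟨ -‿inverseʳ (ordinate (φ u)) ⟨
        ordinate (φ u) - ordinate (φ u)     ≤⟨ +-monoʳ-≤ _ (proj₂ (proj₂ below) u) ⟩
        ordinate (φ u) + B                  ∎

      m = proj₁ ([1+x]^n≤1+mx 5)
      0≤m = proj₁ (proj₂ ([1+x]^n≤1+mx 5))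
      [1+x]⁵≤1+mx = proj₂ (proj₂ ([1+x]^n≤1+mx 5))

      -- K makes K ε dominate every perturbation below, and the factor 1 + Q of
      -- 1 / ε keeps r² (1 + m K ε) below every D u v > r².
      K = 1# + (fromℕ 4 * r² + (A + B))
      Q = r² * m * H

      0≤4r² : 0# ≤ fromℕ 4 * r²
      0≤4r² = *-nonneg (fromℕ-nonneg 4) 0≤r²

      0≤A+B : 0# ≤ A + B
      0≤A+B = +-nonneg 0≤A 0≤B

      0<K : 0# < K
      0<K = 0<1+x (+-nonneg 0≤4r² 0≤A+B)

      1≤K : 1# ≤ K
      1≤K = x≤x+y (+-nonneg 0≤4r² 0≤A+B)

      rest≤K : fromℕ 4 * r² + (A + B) ≤ K
      rest≤K = ≤.trans (x≤x+y 0≤1) (≤.reflexive (+-comm _ 1#))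

      4r²≤K : fromℕ 4 * r² ≤ K
      4r²≤K = ≤.trans (x≤x+y 0≤A+B) rest≤K

      b+B≤K : ∀ u → ordinate (φ u) + B ≤ K
      b+B≤K u = ≤.trans (+-monoˡ-≤ B (proj₂ (proj₂ above) u))
        (≤.trans (≤.trans (x≤x+y 0≤4r²) (≤.reflexive (+-comm _ _))) rest≤K)

      0≤Q : 0# ≤ Q
      0≤Q = *-nonneg (*-nonneg 0≤r² 0≤m) 0≤H

      0<K[1+Q] : 0# < K * (1# + Q)
      0<K[1+Q] = *-pos 0<K (0<1+x 0≤Q)

      ε = (K * (1# + Q)) ⁻¹
      x = K * ε

      0<ε : 0# < ε
      0<ε = ⁻¹-pos 0<K[1+Q]

      0≤ε = proj₁ 0<ε

      0≤x : 0# ≤ x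
      0≤x = *-nonneg (proj₁ 0<K) 0≤ε

      -- Thus x = 1 / (1 + Q). Both summands are nonnegative, so each is at most 1.
      x+xQ≈1 : x + x * Q ≈ 1#
      x+xQ≈1 = begin-equality
        K * ε + K * ε * Q        ≈⟨ solve 3 (λ k e q → k :* e :+ k :* e :* q
                                     := k :* (con 1 :+ q) :* e) refl K ε Q ⟩
        K * (1# + Q) * ε         ≈⟨ ⁻¹-inverseʳ (<⇒≉0 0<K[1+Q]) ⟩
        1#                       ∎

      x≤1 : x ≤ 1#
      x≤1 = ≤.trans (x≤x+y (*-nonneg 0≤x 0≤Q)) (≤.reflexive x+xQ≈1)

      xQ≤1 : x * Q ≤ 1#
      xQ≤1 = ≤.trans (x≤x+y 0≤x) (≤.reflexive (trans (+-comm (x * Q) x) x+xQ≈1))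

      -- Applied to 1, to 4r² and to the shifted ordinates, this compares ε, `wider * wider` and the
      -- heights with `x`; hence the summands of `K`.
      ε*≤x : ∀ {y} → y ≤ K → ε * y ≤ x
      ε*≤x y≤K = ≤.trans (*-monoˡ-≤ 0≤ε y≤K) (≤.reflexive (*-comm ε K))

      ε≤x : ε ≤ x
      ε≤x = ≤.trans (≤.reflexive (sym (*-identityʳ ε))) (ε*≤x 1≤K)

    -- The embedded points and the threshold.

    height : Fin n → Carrier
    height u = 1# + ε * (ordinate (φ u) + B)

    private
      1≤height : ∀ u → 1# ≤ height u
      1≤height u = x≤x+y (*-nonneg 0≤ε (0≤b+B u))

      0≤height : ∀ u → 0# ≤ height u
      0≤height u = ≤.trans 0≤1 (1≤height u)

      height≤1+x : ∀ u → height u ≤ 1# + x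
      height≤1+x u = +-monoʳ-≤ 1# (ε*≤x (b+B≤K u))

    ψ : Fin n → ℍ²
    ψ u = record
      { x   = ε * abscissa (φ u)
      ; y   = height u
      ; 0<y = 0<1+x (*-nonneg 0≤ε (0≤b+B u))
      }

    radius : Carrier
    radius = ε * R

    0<radius : 0# < radius
    0<radius = *-pos 0<ε 0<R

    -- Perturbation estimates.

    private
      -- `≤arcosh` gives only a weak inequality, so a far pair is compared with a radius strictly
      -- above the threshold.
      wider = radius * (1# + ε)

      0≤wider : 0# ≤ wider
      0≤wider = *-nonneg (proj₁ 0<radius) (+-nonneg 0≤1 0≤ε)

      wider≰radius : ¬ (wider ≤ radius)
      wider≰radius wider≤radius = proj₂ (*-pos 0<radius 0<ε)
        (≤.antisym (proj₁ (*-pos 0<radius 0<ε)) (+-cancelʳ-≤ radius (begin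
          radius * ε + radius   ≈⟨ solve 2 (λ c e → c :* e :+ c := c :* (con 1 :+ e))
                                     refl radius ε ⟩
          wider                 ≤⟨ wider≤radius ⟩
          radius                ≈⟨ +-identityˡ radius ⟨
          0# + radius           ∎)))

      -- wider² = ε r² · ε(1 + ε)², and ε ≤ 1 makes ε(1 + ε)² at most 4.
      wider²≤x : wider * wider ≤ x
      wider²≤x = begin
        wider * wider
          ≈⟨ solve 2 (λ e r → e :* r :* (con 1 :+ e) :* (e :* r :* (con 1 :+ e))
               := e :* (r :* r) :* (e :* ((con 1 :+ e) :* (con 1 :+ e)))) refl ε R ⟩
        ε * r² * (ε * ((1# + ε) * (1# + ε)))
          ≤⟨ *-monoˡ-≤ (*-nonneg 0≤ε 0≤r²) (*-mono-≤ 0≤1 (square-nonneg _) ε≤1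
               (*-mono-≤ (+-nonneg 0≤1 0≤1) (+-nonneg 0≤1 0≤ε)
                 (+-monoʳ-≤ 1# ε≤1) (+-monoʳ-≤ 1# ε≤1))) ⟩
        ε * r² * (1# * ((1# + 1#) * (1# + 1#)))
          ≈⟨ solve 2 (λ e q → e :* q :* (con 1 :* ((con 1 :+ con 1) :* (con 1 :+ con 1)))
               := e :* ((con 1 :+ (con 1 :+ (con 1 :+ (con 1 :+ con 0)))) :* q)) refl ε r² ⟩
        ε * (fromℕ 4 * r²)
          ≤⟨ ε*≤x 4r²≤K ⟩
        x ∎
        where
        ε≤1 : ε ≤ 1#
        ε≤1 = ≤.trans ε≤x x≤1

      -- There are five factors, each at most 1 + x: two come from `wider` against `radius`, one
      -- from the upper bound for cosh, and two are the heights in the denominator of cosh of the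
      -- distance.
      perturbation : ∀ u v → (1# + ε) * (1# + ε) * (1# + wider * wider) *
                             (height u * height v) ≤ 1# + m * x
      perturbation u v = begin
        (1# + ε) * (1# + ε) * (1# + wider * wider) * (height u * height v)
          ≤⟨ *-mono-≤ (*-nonneg (*-nonneg 0≤1+x 0≤1+x) 0≤1+x)
               (*-nonneg (0≤height u) (0≤height v))
               (*-mono-≤ (*-nonneg 0≤1+x 0≤1+x) (+-nonneg 0≤1 (square-nonneg wider))
                 (*-mono-≤ 0≤1+x (+-nonneg 0≤1 0≤ε) 1+ε≤1+x 1+ε≤1+x)
                 (+-monoʳ-≤ 1# wider²≤x))
               (*-mono-≤ 0≤1+x (0≤height v) (height≤1+x u) (height≤1+x v)) ⟩
        (1# + x) * (1# + x) * (1# + x) * ((1# + x) * (1# + x))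
          ≈⟨ solve 1 (λ y → y :* y :* y :* (y :* y) := y :* (y :* (y :* (y :* (y :* con 1)))))
               refl (1# + x) ⟩
        (1# + x) ^ 5
          ≤⟨ [1+x]⁵≤1+mx 0≤x x≤1 ⟩
        1# + m * x ∎
        where
        0≤1+x : 0# ≤ 1# + x
        0≤1+x = +-nonneg 0≤1 0≤x

        1+ε≤1+x : 1# + ε ≤ 1# + x
        1+ε≤1+x = +-monoʳ-≤ 1# ε≤x

      -- With d = D - r² the bound on inverse gaps gives 1 ≤ dH, so r²mx ≤ r²mx · dH = d · xQ ≤ d.
      gap : ∀ u v → r² < D u v → r² * (1# + m * x) ≤ D u v
      gap u v r²<D = begin
        r² * (1# + m * x)                ≈⟨ solve 3 (λ q m x → q :* (con 1 :+ m :* x)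
                                              := q :* m :* x :+ q) refl r² m x ⟩
        r² * m * x + r²                  ≤⟨ +-monoˡ-≤ r² (begin
          r² * m * x                       ≤⟨ x≤x*y (*-nonneg (*-nonneg 0≤r² 0≤m) 0≤x) 1≤dH ⟩
          r² * m * x * (d * H)             ≈⟨ solve 5 (λ q m x d h → q :* m :* x :* (d :* h)
                                                := d :* (x :* (q :* m :* h))) refl r² m x d H ⟩
          d * (x * Q)                      ≤⟨ *-monoˡ-≤ (proj₁ 0<d) xQ≤1 ⟩
          d * 1#                           ≈⟨ *-identityʳ d ⟩
          d                                ∎) ⟩
        d + r²                           ≈⟨ x-y+y≈x (D u v) r² ⟩
        D u v                            ∎
        where
        d = D u v - r²

        0<d : 0# < d
        0<d = x<y⇒0<y-x r²<D

        1≤dH : 1# ≤ d * H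
        1≤dH = begin
          1#        ≈⟨ ⁻¹-inverseʳ (<⇒≉0 0<d) ⟨
          d * d ⁻¹  ≤⟨ *-monoˡ-≤ (proj₁ 0<d) (gap⁻¹≤H u v) ⟩
          d * H     ∎

      sqDist-ψ : ∀ u v → sqDist (ℍ².x (ψ u)) (ℍ².y (ψ u)) (ℍ².x (ψ v)) (ℍ².y (ψ v)) ≈
                         ε * ε * D u v
      sqDist-ψ u v = sqDist-scale ε B _ _ _ _

    -- Agreement of the two adjacency relations.

    -- Both heights are at least 1, so dividing by their product only lowers cosh of the distance,
    -- which is therefore at most 1 + (εR)²/2.
    near : ∀ u v → D u v ≤ r² → distH (ψ u) (ψ v) ≤ radius
    near u v D≤r² = arcosh≤ (proj₁ 0<radius) (coshDistH≤ (ψ u) (ψ v) (begin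
      sqDist (ℍ².x (ψ u)) (ℍ².y (ψ u)) (ℍ².x (ψ v)) (ℍ².y (ψ v))  ≈⟨ sqDist-ψ u v ⟩
      ε * ε * D u v                             ≤⟨ *-monoˡ-≤ (square-nonneg ε) D≤r² ⟩
      ε * ε * r²                                ≈⟨ solve 2 (λ e r → e :* e :* (r :* r)
                                                     := e :* r :* (e :* r)) refl ε R ⟩
      radius * radius                           ≤⟨ x≤x*y (square-nonneg radius) 1≤P ⟩
      radius * radius * (height u * height v)   ∎))
      where
      1≤P : 1# ≤ height u * height v
      1≤P = ≤.trans (1≤height u) (x≤x*y (0≤height u) (1≤height v))

    -- With c = `wider`, c²(1 + c²)P equals ε²r² times the product in `perturbation`, and `gap`
    -- brings this below ε²D. So `wider` is at most the distance, which cannot then be at most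
    -- `radius`.
    far : ∀ u v → r² < D u v → ¬ (distH (ψ u) (ψ v) ≤ radius)
    far u v r²<D d≤radius = wider≰radius (≤.trans
      (≤arcosh 0≤wider (≤.trans wider²≤x x≤1) (≤coshDistH (ψ u) (ψ v) (begin
        wider * wider * (1# + wider * wider) * P
          ≈⟨ solve 4 (λ e r w p → e :* r :* (con 1 :+ e) :* (e :* r :* (con 1 :+ e)) :* w :* p
               := e :* e :* (r :* r :* ((con 1 :+ e) :* (con 1 :+ e) :* w :* p)))
               refl ε R (1# + wider * wider) P ⟩
        ε * ε * (r² * ((1# + ε) * (1# + ε) * (1# + wider * wider) * P))
          ≤⟨ *-monoˡ-≤ (square-nonneg ε)
               (≤.trans (*-monoˡ-≤ 0≤r² (perturbation u v)) (gap u v r²<D)) ⟩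
        ε * ε * D u v
          ≈⟨ sqDist-ψ u v ⟨
        sqDist (ℍ².x (ψ u)) (ℍ².y (ψ u)) (ℍ².x (ψ v)) (ℍ².y (ψ v)) ∎)))
      d≤radius)
      where P = height u * height v

    distE≤⇒distH≤ : ∀ u v → distE (φ u) (φ v) ≤ R → distH (ψ u) (ψ v) ≤ radius
    distE≤⇒distH≤ u v = near u v ∘ sqrt≤⇒≤square 0<R

    distH≤⇒distE≤ : ∀ u v → distH (ψ u) (ψ v) ≤ radius → distE (φ u) (φ v) ≤ R
    distH≤⇒distE≤ u v d≤radius = ≤square⇒sqrt≤ (proj₁ 0<R)
      -- The order is decidable, so it suffices to refute r² < D.
      (decidable-stable (D u v ≤.≤? r²) λ D≰r² →
        far u v (<.≰⇒> sym ≤.reflexive ≤.total D≰r²) d≤radius)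

theorem1 : (ℝ : CompleteOrderedField) (n : ℕ) (G : Graph n) →
    IsEuclideanUnitDiskGraph ℝ G → IsHyperbolicUnitDiskGraph ℝ G
theorem1 ℝ n G (φ , R , 0<R , adjacent) =
  ψ , radius , 0<radius , λ u v u≢v →
    let open Equivalence (adjacent u v u≢v) in
    mk⇔ (distE≤⇒distH≤ u v ∘ to) (from ∘ distH≤⇒distE≤ u v)
  where open Embedding ℝ φ R 0<R
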